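{- Let $K$ be a field and let $v : K \to \mathbb{Z}_{\mathrm{m}0}$ be a discrete valuation on $K$. Then the unit ball $K^\circ = \{x \in K : v(x) \le 1\}$ is a discrete valuation ring.
   Context: $\mathbb{Z}_{\mathrm{m}0}$ is the linearly ordered commutative group with zero obtained from the multiplicatively written ordered group $\mathbb{Z}$ (an infinite cyclic group with elements $\mathrm{of\_add}(n)$, $n\in\mathbb{Z}$, with $\mathrm{of\_add}(a+b)=\mathrm{of\_add}(a)\,\mathrm{of\_add}(b)$, $\mathrm{of\_add}(0)=1$, and $\mathrm{of\_add}(a)\le\mathrm{of\_add}(b)$ iff $a\le b$) by adjoining an absorbing smallest element $0$. A (multiplicative) valuation on a commutative unitary ring $R$ is a function $v: R\to \mathbb{Z}_{\mathrm{m}0}$ with $v(0)=0$, $v(1)=1$, $v(xy)=v(x)v(y)$ and $v(x+y)\le\max\{v(x),v(y)\}$ for all $x,y\in R$. A valuation is called discrete if it is $\mathbb{Z}_{\mathrm{m}0}$-valued and surjective onto $\mathbb{Z}_{\mathrm{m}0}$ (i.e. normalized). A discrete valuation ring is a local principal ideal domain that is not a field. -}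

module Defs where

open import Algebra using (CommutativeRing; RawRing)
import Algebra.Construct.NaturalChoice.Max as Max
import Algebra.Definitions as AlgebraDefinitions
import Algebra.Definitions.RawMagma as RawMagmaDefinitions
open import Algebra.Morphism.Structures using (IsRingMonomorphism)
import Algebra.Morphism.RingMonomorphism as RingMonomorphism
import Algebra.Properties.Ring as RingProperties
open import Data.Integer.Base as ℤ using (ℤ; +_; -[1+_]; 0ℤ)
import Data.Integer.Properties as ℤ
open import Data.Product.Base using (Σ; ∃; _×_; _,_; proj₁)
open import Data.Sum.Base using (_⊎_)
open import Function.Base using (_on_)
open import Function.Definitions using (Surjective)
open import Level using (Level; 0ℓ; suc; _⊔_)
open import Relation.Binary.Bundles using (TotalOrder)
import Relation.Binary.Construct.Add.Infimum.NonStrict as AddInfimum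
open import Relation.Binary.PropositionalEquality
  using (_≡_; sym; trans; subst)
open import Relation.Nullary.Construct.Add.Infimum using (_₋; ⊥₋; [_])
open import Relation.Nullary.Negation using (¬_)
open import Relation.Unary using (Pred; _∈_; _⊆_; _≐_)

-- The group of exponents is written additively: `ofAdd n` is the n-th power of
-- the generator, so multiplication in ℤₘ₀ is addition of exponents.

ℤₘ₀ : Set
ℤₘ₀ = ℤ ₋

pattern 0ₘ      = ⊥₋
pattern ofAdd n = [ n ]

1ₘ : ℤₘ₀
1ₘ = ofAdd 0ℤ

infixl 7 _*ₘ_
_*ₘ_ : ℤₘ₀ → ℤₘ₀ → ℤₘ₀
0ₘ      *ₘ _       = 0ₘ
ofAdd _ *ₘ 0ₘ      = 0ₘ
ofAdd a *ₘ ofAdd b = ofAdd (a ℤ.+ b)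

open AddInfimum ℤ._≤_ using (_≤₋_; ⊥₋≤_; [_]; ≤₋-isTotalOrder-≡)

infix 4 _≤ₘ_
_≤ₘ_ : ℤₘ₀ → ℤₘ₀ → Set
_≤ₘ_ = _≤₋_

≤ₘ-totalOrder : TotalOrder 0ℓ 0ℓ 0ℓ
≤ₘ-totalOrder = record { isTotalOrder = ≤₋-isTotalOrder-≡ ℤ.≤-isTotalOrder }

open Max ≤ₘ-totalOrder public using () renaming (_⊔_ to maxₘ; ⊔-lub to maxₘ-lub)

private
  module ≤ₘ = TotalOrder ≤ₘ-totalOrder

  variable
    c ℓ : Level

module _ (R : CommutativeRing c ℓ) where

  open CommutativeRing R
    using (Carrier; _≈_; _≉_; _+_; _*_; 0#; 1#; *-rawMagma)
  open AlgebraDefinitions _≈_ using (Invertible)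
  open RawMagmaDefinitions *-rawMagma using (_∣_)

  record IsField : Set (c ⊔ ℓ) where
    field
      0≉1     : 0# ≉ 1#
      inverse : ∀ x → x ≉ 0# → Invertible 1# _*_ x

  record IsIntegralDomain : Set (c ⊔ ℓ) where
    field
      0≉1            : 0# ≉ 1#
      noZeroDivisors : ∀ x y → x * y ≈ 0# → x ≈ 0# ⊎ y ≈ 0#

  -- Closure under negation follows from absorption, as - x ≈ (- 1#) * x.
  record Ideal (p : Level) : Set (c ⊔ ℓ ⊔ suc p) where
    field
      members  : Pred Carrier p
      resp     : ∀ {x y} → x ≈ y → x ∈ members → y ∈ members
      0∈       : 0# ∈ members
      +-closed : ∀ {x y} → x ∈ members → y ∈ members → x + y ∈ members
      absorbs  : ∀ r {x} → x ∈ members → r * x ∈ members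

  open Ideal using (members)

  module _ {p : Level} where

    IsPrincipal : Ideal p → Set (c ⊔ ℓ ⊔ p)
    IsPrincipal I = ∃ λ a → members I ≐ (a ∣_)

    IsProper : Ideal p → Set (c ⊔ p)
    IsProper I = ¬ (∀ x → x ∈ members I)

    record IsMaximal (I : Ideal p) : Set (c ⊔ ℓ ⊔ suc p) where
      field
        proper  : IsProper I
        maximal : ∀ (J : Ideal p) → IsProper J → members I ⊆ members J →
                  members J ⊆ members I

  -- The level p is the one at which the subsets of R that may be ideals live.
  module _ (p : Level) where

    record IsPrincipalIdealDomain : Set (c ⊔ ℓ ⊔ suc p) where
      field
        isIntegralDomain : IsIntegralDomain
        isPrincipal      : ∀ (I : Ideal p) → IsPrincipal I

    -- Exactly one maximal ideal.
    record IsLocal : Set (c ⊔ ℓ ⊔ suc p) where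
      field
        maximalIdeal : Ideal p
        isMaximal    : IsMaximal maximalIdeal
        unique       : ∀ (J : Ideal p) → IsMaximal J →
                       members J ≐ members maximalIdeal

    record IsDiscreteValuationRing : Set (c ⊔ ℓ ⊔ suc p) where
      field
        isLocal                : IsLocal
        isPrincipalIdealDomain : IsPrincipalIdealDomain
        notField               : ¬ IsField

record Valuation (R : CommutativeRing c ℓ) : Set (c ⊔ ℓ) where
  open CommutativeRing R using (Carrier; _≈_; _+_; _*_; 0#; 1#)
  field
    val    : Carrier → ℤₘ₀
    v-cong : ∀ {x y} → x ≈ y → val x ≡ val y
    v-0    : val 0# ≡ 0ₘ
    v-1    : val 1# ≡ 1ₘ
    v-*    : ∀ x y → val (x * y) ≡ val x *ₘ val y
    v-+    : ∀ x y → val (x + y) ≤ₘ maxₘ (val x) (val y)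

  IsDiscrete : Set (c ⊔ ℓ)
  IsDiscrete = Surjective _≈_ _≡_ val

module _ (R : CommutativeRing c ℓ) (v : Valuation R) where

  open CommutativeRing R
    using (Carrier; _≈_; _+_; _*_; -_; 0#; 1#; isCommutativeRing; rawRing; ring)
    renaming (refl to ≈-refl; trans to ≈-trans)
  open RingProperties ring using (-1*x≈-x; -‿involutive)
  open Valuation v

  private
    *ₘ-≤1 : ∀ {a b} → a ≤ₘ 1ₘ → b ≤ₘ 1ₘ → a *ₘ b ≤ₘ 1ₘ
    *ₘ-≤1 (⊥₋≤ _) _        = ⊥₋≤ _
    *ₘ-≤1 [ _ ]   (⊥₋≤ _)  = ⊥₋≤ _
    *ₘ-≤1 [ a≤0 ] [ b≤0 ]  = [ ℤ.+-mono-≤ a≤0 b≤0 ]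

    square≡1 : ∀ a → a *ₘ a ≡ 1ₘ → a ≤ₘ 1ₘ
    square≡1 0ₘ               ()
    square≡1 (ofAdd (+ 0))      _ = ≤ₘ.refl
    square≡1 (ofAdd (ℤ.+[1+ _ ])) ()
    square≡1 (ofAdd -[1+ _ ])   ()

    v[-1]≤1 : val (- 1#) ≤ₘ 1ₘ
    v[-1]≤1 = square≡1 (val (- 1#))
      (trans (sym (v-* (- 1#) (- 1#)))
        (trans (v-cong (≈-trans (-1*x≈-x (- 1#)) (-‿involutive 1#))) v-1))

    0≤1 : val 0# ≤ₘ 1ₘ
    0≤1 = subst (_≤ₘ 1ₘ) (sym v-0) (⊥₋≤ _)

    1≤1 : val 1# ≤ₘ 1ₘ
    1≤1 = ≤ₘ.reflexive v-1

    +-≤1 : ∀ {x y} → val x ≤ₘ 1ₘ → val y ≤ₘ 1ₘ → val (x + y) ≤ₘ 1ₘ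
    +-≤1 p q = ≤ₘ.trans (v-+ _ _) (maxₘ-lub p q)

    *-≤1 : ∀ {x y} → val x ≤ₘ 1ₘ → val y ≤ₘ 1ₘ → val (x * y) ≤ₘ 1ₘ
    *-≤1 p q = subst (_≤ₘ 1ₘ) (sym (v-* _ _)) (*ₘ-≤1 p q)

    -‿≤1 : ∀ {x} → val x ≤ₘ 1ₘ → val (- x) ≤ₘ 1ₘ
    -‿≤1 p = subst (_≤ₘ 1ₘ) (v-cong (-1*x≈-x _)) (*-≤1 v[-1]≤1 p)

  unitBallRaw : RawRing c ℓ
  unitBallRaw = record
    { Carrier = Σ Carrier λ x → val x ≤ₘ 1ₘ
    ; _≈_     = _≈_ on proj₁
    ; _+_     = λ (x , p) (y , q) → x + y , +-≤1 p q
    ; _*_     = λ (x , p) (y , q) → x * y , *-≤1 p q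
    ; -_      = λ (x , p) → - x , -‿≤1 p
    ; 0#      = 0# , 0≤1
    ; 1#      = 1# , 1≤1
    }

  private
    inclusion : IsRingMonomorphism unitBallRaw rawRing proj₁
    inclusion = record
      { isRingHomomorphism = record
        { isSemiringHomomorphism = record
          { isNearSemiringHomomorphism = record
            { +-isMonoidHomomorphism = record
              { isMagmaHomomorphism = record
                { isRelHomomorphism = record { cong = λ x≈y → x≈y }
                ; homo = λ _ _ → ≈-refl
                }
              ; ε-homo = ≈-refl
              }
            ; *-homo = λ _ _ → ≈-refl
            }
          ; 1#-homo = ≈-refl
          }
        ; -‿homo = λ _ → ≈-refl
        }
      ; injective = λ x≈y → x≈y
      }

  unitBall : CommutativeRing c ℓ
  unitBall = record
    { RawRing unitBallRaw
    ; isCommutativeRing =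
        RingMonomorphism.isCommutativeRing inclusion isCommutativeRing
    }

{-# OPTIONS --safe #-}

-- In the unit ball x divides y exactly when v y ≤ v x. Exponents ≤ 0 satisfy the
-- ascending chain condition, so every ideal has an element of greatest value,
-- and that element generates it. The elements of value < 1 form an ideal, and any
-- element outside it divides everything, so this ideal contains all proper ones.

module Submission where

open import Defs
open import Algebra using (CommutativeRing)
import Algebra.Construct.NaturalChoice.Max as Max
import Algebra.Definitions.RawMagma as RawMagmaDefinitions
open import Axiom.DoubleNegationElimination using (em⇒dne)
open import Axiom.ExcludedMiddle using (ExcludedMiddle)
open import Data.Integer.Base as ℤ using (0ℤ; -1ℤ; ∣_∣)
import Data.Integer.Properties as ℤ
open import Data.Nat.Base as ℕ using (z<s; s<s)
open import Data.Nat.Induction using (<-wellFounded)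
open import Data.Product.Base using (Σ; ∃; _×_; _,_)
open import Data.Sum.Base as Sum using (_⊎_; inj₁; inj₂)
open import Function.Base using (_∘_)
open import Induction.WellFounded using (Acc; acc; WellFounded)
open import Level using (Level; _⊔_; Lift; lift; lower)
open import Relation.Binary.Bundles using (TotalOrder)
open import Relation.Binary.Construct.Add.Infimum.NonStrict ℤ._≤_
  using (⊥₋≤_; [_]; [≤]-injective; ≤₋-dec)
open import Relation.Binary.Definitions using (Decidable)
open import Relation.Binary.PropositionalEquality
  using (_≡_; _≢_; refl; sym; trans; subst; subst₂; cong)
import Relation.Binary.Reasoning.Setoid as SetoidReasoning
open import Relation.Nullary.Decidable using (yes; no; map′; decidable-stable)
open import Relation.Nullary.Negation using (¬_; contradiction)
open import Relation.Unary using (Pred; _∈_; _⊆_)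

private
  variable
    a c ℓ : Level

  module ≤ₘ = TotalOrder ≤ₘ-totalOrder

open Max ≤ₘ-totalOrder using (⊔-sel)

-- Excluded middle is assumed once, at a joint level, but applied at lower ones.
lower-em : ∀ b → ExcludedMiddle (a ⊔ b) → ExcludedMiddle a
lower-em b em {P} = map′ lower lift (em {Lift b P})

infix 4 _≤ₘ?_
_≤ₘ?_ : Decidable _≤ₘ_
_≤ₘ?_ = ≤₋-dec ℤ._≤?_

1≰0 : ¬ (1ₘ ≤ₘ 0ₘ)
1≰0 ()

1≰-1 : ¬ (1ₘ ≤ₘ ofAdd -1ℤ)
1≰-1 [ () ]

*ₘ-≤ʳ : ∀ {x} y → x ≤ₘ 1ₘ → x *ₘ y ≤ₘ y
*ₘ-≤ʳ y         (⊥₋≤ _)           = ⊥₋≤ y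
*ₘ-≤ʳ 0ₘ        [ _ ]             = ⊥₋≤ 0ₘ
*ₘ-≤ʳ (ofAdd n) ([_] {k = m} m≤0) =
  [ subst (m ℤ.+ n ℤ.≤_) (ℤ.+-identityˡ n) (ℤ.+-monoˡ-≤ n m≤0) ]

-- Serves to place a quotient in the unit ball: `y` will be the value of the divisor and `x` that of
-- the quotient.
*ₘ-cancelʳ-≤1 : ∀ x {y} → y ≢ 0ₘ → x *ₘ y ≤ₘ y → x ≤ₘ 1ₘ
*ₘ-cancelʳ-≤1 0ₘ        _   _ = ⊥₋≤ 1ₘ
*ₘ-cancelʳ-≤1 (ofAdd m) {0ₘ}      y≢0 _ = contradiction refl y≢0
*ₘ-cancelʳ-≤1 (ofAdd m) {ofAdd n} _ [ m+n≤n ] =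
  [ ℤ.≮⇒≥ (λ 0<m → ℤ.≤⇒≯ m+n≤n
      (subst (ℤ._< m ℤ.+ n) (ℤ.+-identityˡ n) (ℤ.+-monoˡ-< n 0<m))) ]

*ₘ-noZeroDivisors : ∀ x y → x *ₘ y ≡ 0ₘ → x ≡ 0ₘ ⊎ y ≡ 0ₘ
*ₘ-noZeroDivisors 0ₘ        _  _ = inj₁ refl
*ₘ-noZeroDivisors (ofAdd _) 0ₘ _ = inj₂ refl

≤maxₘ : ∀ {x} y z → x ≤ₘ maxₘ y z → x ≤ₘ y ⊎ x ≤ₘ z
≤maxₘ {x} y z x≤max =
  Sum.map (λ max≡y → subst (x ≤ₘ_) max≡y x≤max)
          (λ max≡z → subst (x ≤ₘ_) max≡z x≤max) (⊔-sel y z)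

-- On exponents at most 0 the absolute value reverses the order, giving a natural number that drops
-- as the exponent climbs.
<⇒∣∣> : ∀ {i j} → i ℤ.< j → j ℤ.≤ 0ℤ → ∣ j ∣ ℕ.< ∣ i ∣
<⇒∣∣> (ℤ.-<- n<m)           _ = s<s n<m
<⇒∣∣> (ℤ.-<+ {n = ℕ.zero})  _ = z<s
<⇒∣∣> (ℤ.-<+ {n = ℕ.suc _}) (ℤ.+≤+ ())
<⇒∣∣> (ℤ.+<+ (ℕ.s≤s _))     (ℤ.+≤+ ())

infix 4 _≻_
-- Accessibility runs upwards: `Acc` at a value asks for all greater ones. The bound by `1ₘ` is
-- built in, since unbounded exponents climb forever.
_≻_ : (x y : Σ ℤₘ₀ (_≤ₘ 1ₘ)) → Set
(x , _) ≻ (y , _) = ¬ (x ≤ₘ y)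

-- The reversed order has type ω + 1. Nonzero values are handled by induction on the absolute value
-- of the exponent; `0ₘ` has infinitely many values above it, but each is already accessible.
≻-wellFounded : WellFounded _≻_
≻-wellFounded (x , x≤1) = go x x≤1
  where
  ofAdd-acc : ∀ n (n≤0 : ofAdd n ≤ₘ 1ₘ) → Acc ℕ._<_ ∣ n ∣ → Acc _≻_ (ofAdd n , n≤0)
  ofAdd-acc n n≤0 (acc rs) = acc (λ {y} → above y)
    where
    above : ∀ y → y ≻ (ofAdd n , n≤0) → Acc _≻_ y
    above (0ₘ      , _)   0≰n = contradiction (⊥₋≤ ofAdd n) 0≰n
    above (ofAdd m , m≤0) m≰n = ofAdd-acc m m≤0
      (rs (<⇒∣∣> (ℤ.≰⇒> (m≰n ∘ [_])) ([≤]-injective m≤0)))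

  go : ∀ x x≤1 → Acc _≻_ (x , x≤1)
  go (ofAdd n) n≤0 = ofAdd-acc n n≤0 (<-wellFounded ∣ n ∣)
  go 0ₘ        0≤1 = acc (λ {y} → above y)
    where
    above : ∀ y → y ≻ (0ₘ , 0≤1) → Acc _≻_ y
    above (0ₘ      , _)   0≰0 = contradiction ≤ₘ.refl 0≰0
    above (ofAdd m , m≤0) _   = ofAdd-acc m m≤0 (<-wellFounded ∣ m ∣)

module _ (K : CommutativeRing c ℓ) (isField : IsField K) (v : Valuation K) where

  private
    module K = CommutativeRing K
    module B = CommutativeRing (unitBall K v)
  open K using (_≈_; _*_; 0#; 1#)
  open IsField isField
  open Valuation v
  open RawMagmaDefinitions B.*-rawMagma using (_∣_; _,_)
  open Ideal using (members)

  vᴮ : B.Carrier → ℤₘ₀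
  vᴮ (x , _) = val x

  -- An inverse of `x` would give 1 = v(xy) = 0. The double negation remains because a field inverts
  -- only what is known to differ from zero.
  v≡0⇒¬≉0 : ∀ {x} → val x ≡ 0ₘ → ¬ ¬ (x ≈ 0#)
  v≡0⇒¬≉0 {x} vx≡0 x≉0 with y , _ , xy≈1 ← inverse x x≉0 =
    contradiction
      (trans (sym (cong (_*ₘ val y) vx≡0))
        (trans (sym (v-* x y)) (trans (v-cong xy≈1) v-1)))
      λ ()

  v≢0⇒≉0 : ∀ {x} → val x ≢ 0ₘ → ¬ (x ≈ 0#)
  v≢0⇒≉0 vx≢0 x≈0 = vx≢0 (trans (v-cong x≈0) v-0)

  -- The quotient is formed in `K`; cancelling the nonzero value of `x` shows that it lies in the
  -- unit ball.
  ≢0∧≤⇒∣ : ∀ x y → vᴮ x ≢ 0ₘ → vᴮ y ≤ₘ vᴮ x → x ∣ y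
  ≢0∧≤⇒∣ (x , _) (y , _) vx≢0 vy≤vx with z , zx≈1 , _ ← inverse x (v≢0⇒≉0 vx≢0) =
    (y * z , *ₘ-cancelʳ-≤1 (val (y * z)) vx≢0
               (subst (_≤ₘ val x) (trans (v-cong (K.sym yzx≈y)) (v-* (y * z) x)) vy≤vx))
    , yzx≈y
    where
    open SetoidReasoning K.setoid
    yzx≈y : y * z * x ≈ y
    yzx≈y = begin
      y * z * x   ≈⟨ K.*-assoc y z x ⟩
      y * (z * x) ≈⟨ K.*-congˡ zx≈1 ⟩
      y * 1#      ≈⟨ K.*-identityʳ y ⟩
      y           ∎

  ∣⇒≤ : ∀ x y → x ∣ y → vᴮ y ≤ₘ vᴮ x
  ∣⇒≤ (x , _) (y , _) ((q , vq≤1) , qx≈y) =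
    subst (_≤ₘ val x) (trans (sym (v-* q x)) (v-cong qx≈y)) (*ₘ-≤ʳ (val x) vq≤1)

  1≤⇒∣ : ∀ x → 1ₘ ≤ₘ vᴮ x → ∀ y → x ∣ y
  1≤⇒∣ x 1≤vx y@(_ , vy≤1) =
    ≢0∧≤⇒∣ x y (λ vx≡0 → 1≰0 (subst (1ₘ ≤ₘ_) vx≡0 1≤vx)) (≤ₘ.trans vy≤1 1≤vx)

  module _ {p : Level} where

    ∣-closed : ∀ (I : Ideal (unitBall K v) p) {x y} → x ∈ members I → x ∣ y → y ∈ members I
    ∣-closed I x∈I (q , qx≈y) = Ideal.resp I qx≈y (Ideal.absorbs I q x∈I)

    -- By totality of the order, the negation says that the value is below 1; `Lift` moves it to the
    -- level demanded of ideals.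
    <1-ideal : Ideal (unitBall K v) p
    <1-ideal = record
      { members  = λ x → Lift p (¬ (1ₘ ≤ₘ vᴮ x))
      ; resp     = λ x≈y (lift 1≰vx) → lift (1≰vx ∘ subst (1ₘ ≤ₘ_) (sym (v-cong x≈y)))
      ; 0∈       = lift (1≰0 ∘ subst (1ₘ ≤ₘ_) v-0)
      -- The maximum is one of the two values, so a sum of value at least 1 would have a summand of
      -- value at least 1.
      ; +-closed = λ (lift 1≰vx) (lift 1≰vy) → lift λ 1≤v[x+y] →
          Sum.[ 1≰vx , 1≰vy ] (≤maxₘ _ _ (≤ₘ.trans 1≤v[x+y] (v-+ _ _)))
      ; absorbs  = λ r {x} (lift 1≰vx) → lift λ 1≤v[rx] →
          1≰vx (≤ₘ.trans 1≤v[rx] (∣⇒≤ x (r B.* x) (r , B.refl {r B.* x})))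
      }

    <1-proper : IsProper (unitBall K v) <1-ideal
    <1-proper all∈ = lower (all∈ B.1#) (≤ₘ.reflexive (sym v-1))

    proper⊆<1 : ∀ (J : Ideal (unitBall K v) p) → IsProper (unitBall K v) J →
                members J ⊆ members <1-ideal
    proper⊆<1 J proper {x} x∈J = lift λ 1≤vx →
      proper λ y → ∣-closed J x∈J (1≤⇒∣ x 1≤vx y)

    unitBall-isLocal : IsLocal (unitBall K v) p
    unitBall-isLocal = record
      { maximalIdeal = <1-ideal
      ; isMaximal    = record
        { proper  = <1-proper
        ; maximal = λ J proper _ → proper⊆<1 J proper
        }
      ; unique       = λ J J-max → let open IsMaximal J-max in
          proper⊆<1 J proper , maximal <1-ideal <1-proper (proper⊆<1 J proper)
      }

  module _ (em : ExcludedMiddle ℓ) where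

    v≡0⇒≈0 : ∀ {x} → val x ≡ 0ₘ → x ≈ 0#
    v≡0⇒≈0 = em⇒dne em ∘ v≡0⇒¬≉0

    unitBall-isIntegralDomain : IsIntegralDomain (unitBall K v)
    unitBall-isIntegralDomain = record
      { 0≉1            = 0≉1
      ; noZeroDivisors = λ (x , _) (y , _) xy≈0 →
          Sum.map (v≡0⇒≈0 {x}) (v≡0⇒≈0 {y}) (*ₘ-noZeroDivisors (val x) (val y)
            (trans (sym (v-* x y)) (trans (v-cong xy≈0) v-0)))
      }

    ≤⇒∣ : ∀ x y → vᴮ y ≤ₘ vᴮ x → x ∣ y
    ≤⇒∣ x y vy≤vx with vᴮ x in vx≡
    ... | ofAdd _ = ≢0∧≤⇒∣ x y (λ vx≡0 → contradiction (trans (sym vx≡) vx≡0) λ ())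
                            (subst (vᴮ y ≤ₘ_) (sym vx≡) vy≤vx)
    -- Here `y` has value zero as well, so `y` is zero and the quotient 0 works.
    ... | 0ₘ      = B.0# , K.trans (K.zeroˡ _) (K.sym (v≡0⇒≈0 (≤ₘ.antisym vy≤vx (⊥₋≤ _))))

  module _ {p : Level} (em : ExcludedMiddle (c ⊔ p)) where

    -- Move to a member of greater value as long as excluded middle finds one; `≻-wellFounded` ends
    -- the climb.
    maximum : (S : Pred B.Carrier p) → ∃ (_∈ S) →
              ∃ λ x → x ∈ S × (∀ {y} → y ∈ S → vᴮ y ≤ₘ vᴮ x)
    maximum S (x , x∈S) = go x x∈S (≻-wellFounded _)
      where
      go : ∀ ((x , x≤1) : B.Carrier) → (x , x≤1) ∈ S → Acc _≻_ (val x , x≤1) →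
           ∃ λ x → x ∈ S × (∀ {y} → y ∈ S → vᴮ y ≤ₘ vᴮ x)
      go x x∈S (acc rs) with em {∃ λ y → y ∈ S × ¬ (vᴮ y ≤ₘ vᴮ x)}
      ... | yes (y , y∈S , y≰x) = go y y∈S (rs y≰x)
      ... | no  ∄y = x , x∈S , λ {y} y∈S →
        decidable-stable (vᴮ y ≤ₘ? vᴮ x) (λ y≰x → ∄y (y , y∈S , y≰x))

  -- Surjectivity yields a uniformizer, nonzero with exponent -1. If it were invertible in the ball
  -- it would divide 1, forcing 1 to be at most its value.
  unitBall-notField : IsDiscrete → ¬ IsField (unitBall K v)
  unitBall-notField surjective B-isField =
    let
      π , v[≈π]≡-1 = surjective (ofAdd -1ℤ)
      vπ≡-1        = v[≈π]≡-1 K.refl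
      πᴮ           = π , subst (_≤ₘ 1ₘ) (sym vπ≡-1) [ ℤ.-≤+ ]
      π≉0          = v≢0⇒≉0 λ vπ≡0 → contradiction (trans (sym vπ≡-1) vπ≡0) λ ()
      q , qπ≈1 , _ = IsField.inverse B-isField πᴮ π≉0
    in 1≰-1 (subst₂ _≤ₘ_ v-1 vπ≡-1 (∣⇒≤ πᴮ B.1# (q , qπ≈1)))

mainTheorem1 : ∀ {c ℓ} p → ExcludedMiddle (c ⊔ ℓ ⊔ p) →
    (K : CommutativeRing c ℓ) → IsField K →
    (v : Valuation K) → Valuation.IsDiscrete v →
    IsDiscreteValuationRing (unitBall K v) p
mainTheorem1 {c} {ℓ} p em K isField v surjective = record
  { isLocal                = unitBall-isLocal K isField v
  ; isPrincipalIdealDomain = record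
    { isIntegralDomain = unitBall-isIntegralDomain K isField v emℓ
    ; isPrincipal      = λ I → let
          open Ideal I
          -- Zero lies in every ideal, so the climb has a starting point.
          g , g∈I , ≤vg = maximum K isField v (lower-em ℓ em) members (_ , 0∈)
        in g , (λ {x} x∈I → ≤⇒∣ K isField v emℓ g x (≤vg x∈I))
             , λ {x} → ∣-closed K isField v I {g} {x} g∈I
    }
  ; notField               = unitBall-notField K isField v surjective
  }
  where
  emℓ : ExcludedMiddle ℓ
  emℓ = lower-em (c ⊔ p) em
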